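{- Let $n\ge 1$ and let $a=a_1a_2\cdots a_n$ be a signed permutation on $[n]$. Then $$d_r(a)\geq \frac{2n+1-C(p_r\tilde{s})}{2}.$$
   Context: A signed permutation on $[n]=\{1,\dots,n\}$ is a sequence $a=a_1\cdots a_n$ of non-zero integers such that $|a_1|,\dots,|a_n|$ is a permutation of $[n]$ (each entry carries a sign $+$ or $-$). For $1\le i\le j\le n$, the reversal $\varrho_{i,j}$ changes $a$ into $a_1\cdots a_{i-1}(-a_j)(-a_{j-1})\cdots(-a_{i+1})(-a_i)a_{j+1}\cdots a_n$. The reversal distance $d_r(a)$ is the minimum number of reversals needed to transform $a$ into $e_n=12\cdots n$ (all signs positive). On the set $\{0,1,\dots,n\}\cup\{ -1,-2,\dots,-n\}$ of $2n+1$ elements define the cyclic permutations (in cycle notation) $$\tilde s=(0~a_1~a_2~\cdots~a_n~-a_n~-a_{n-1}~\cdots~-a_2~-a_1),$$ $$p_r=(-1~-2~\cdots~-n+1~-n~n~n-1~\cdots~2~1~0).$$ $C(\pi)$ denotes the number of cycles of a permutation $\pi$ (fixed points included). Products of permutations are compositions of maps (right to left). -}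

module Defs where

open import Data.Bool.Base using (if_then_else_)
open import Data.Integer.Base using (ℤ; +_; -[1+_]; -_; ∣_∣; 0ℤ)
open import Data.Integer.Properties using (_≟_; ∣-i∣≡∣i∣; neg-involutive)
open import Data.List.Base using (List; []; _∷_; _∷ʳ_; [_]; _++_; map; reverse; length; take; drop; upTo; applyUpTo; deduplicate)
open import Data.List.Properties using (≡-dec; ++-assoc; ++-identityʳ; map-++; map-∘; map-cong; unfold-reverse; length-++; length-map; length-reverse; length-applyUpTo; applyUpTo-∷ʳ; take++drop≡id; take-all; drop-all)
open import Data.List.Membership.Propositional using (_∈_)
open import Data.List.Membership.Propositional.Properties using (∈-map⁻; ∈-∃++; ∈-++⁺ʳ)
open import Data.List.Relation.Binary.Permutation.Propositional using (_↭_; ↭-sym; ↭-trans; ↭-reflexive)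
open import Data.List.Relation.Binary.Permutation.Propositional.Properties using (∈-resp-↭; ↭-length; ++⁺ˡ; ↭-reverse; map⁺; drop-mid)
open import Data.List.Relation.Unary.Any using (here)
open import Data.Nat.Base using (ℕ; zero; suc; _+_; _∸_; _≤_; _<_; z≤n; s≤s)
open import Data.Nat.GeneralisedArithmetic using (iterate)
open import Data.Nat.Properties using (anyUpTo?; _≤?_; ≤-refl; ≤-trans; ≤-reflexive; m≤m+n; +-suc; +-comm; m≤n⇒m≤1+n)
open import Data.Product.Base using (∃; _×_; _,_; proj₁)
open import Data.Sum.Base using (_⊎_; inj₁; inj₂)
open import Function.Base using (_∘_)
open import Relation.Binary.PropositionalEquality using (_≡_; refl; sym; trans; cong; subst; module ≡-Reasoning)
open import Relation.Nullary.Decidable using (Dec; yes; no; does; map′; _×-dec_)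
open import Relation.Nullary.Negation using (contradiction)
open import Relation.Unary using (Decidable)

record SignedPermutation (n : ℕ) : Set where
  field
    entries         : List ℤ
    absolute-values : map ∣_∣ entries ↭ applyUpTo suc n

open SignedPermutation public

e : ℕ → List ℤ
e n = applyUpTo (λ k → + suc k) n

-- Positions are counted from 1; used only for 1 ≤ i ≤ j ≤ length a.
ϱ : ℕ → ℕ → List ℤ → List ℤ
ϱ i j a = take (i ∸ 1) a ++ reverse (map -_ (drop (i ∸ 1) (take j a))) ++ drop j a

data SortsIn (n : ℕ) : ℕ → List ℤ → Set where
  done : ∀ {a} → a ≡ e n → SortsIn n 0 a
  step : ∀ {d a} i j → 1 ≤ i → i ≤ j → j ≤ n →
         SortsIn n d (ϱ i j a) → SortsIn n (suc d) a

-- Every signed permutation can be sorted by reversals, so the minimum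
-- defining the reversal distance exists.

sortsIn? : ∀ n a → Decidable (λ d → SortsIn n d a)
sortsIn? n a zero = map′ done (λ { (done eq) → eq }) (≡-dec _≟_ a (e n))
sortsIn? n a (suc d) = map′
  (λ { (j , s≤s j≤n , i , s≤s i≤j , 1≤i , s) → step i j 1≤i i≤j j≤n s })
  (λ { (step i j 1≤i i≤j j≤n s) → j , s≤s j≤n , i , s≤s i≤j , 1≤i , s })
  (anyUpTo? (λ j → anyUpTo? (λ i → (1 ≤? i) ×-dec sortsIn? n (ϱ i j a) d)
                            (suc j))
            (suc n))

private
  take-++ˡ : ∀ {k} (xs ys : List ℤ) → k ≤ length xs → take k (xs ++ ys) ≡ take k xs
  take-++ˡ {zero}  xs       ys le       = refl
  take-++ˡ {suc k} (x ∷ xs) ys (s≤s le) = cong (x ∷_) (take-++ˡ xs ys le)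

  drop-++ˡ : ∀ {k} (xs ys : List ℤ) → k ≤ length xs → drop k (xs ++ ys) ≡ drop k xs ++ ys
  drop-++ˡ {zero}  xs       ys le       = refl
  drop-++ˡ {suc k} (x ∷ xs) ys (s≤s le) = drop-++ˡ xs ys le

  drop-length-++ : ∀ (xs ys : List ℤ) → drop (length xs) (xs ++ ys) ≡ ys
  drop-length-++ []       ys = refl
  drop-length-++ (_ ∷ xs) ys = drop-length-++ xs ys

  take-length-++ : ∀ (xs ys : List ℤ) → take (length xs) (xs ++ ys) ≡ xs
  take-length-++ []       ys = refl
  take-length-++ (x ∷ xs) ys = cong (x ∷_) (take-length-++ xs ys)

  ϱ-suffix : ∀ (xs ys : List ℤ) {m} → length (xs ++ ys) ≡ m →
             ϱ (suc (length xs)) m (xs ++ ys) ≡ xs ++ reverse (map -_ ys)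
  ϱ-suffix xs ys refl
    rewrite take-length-++ xs ys
          | take-all _ (xs ++ ys) ≤-refl
          | drop-all _ (xs ++ ys) ≤-refl
          | drop-length-++ xs ys
          = cong (xs ++_) (++-identityʳ _)

  pred≤ : ∀ {i j} → i ≤ j → i ∸ 1 ≤ j
  pred≤ {zero}  _  = z≤n
  pred≤ {suc i} le = ≤-trans (m≤n⇒m≤1+n ≤-refl) le

  ϱ-∷ʳ : ∀ {i j} (a : List ℤ) z → i ≤ j → j ≤ length a →
         ϱ i j (a ∷ʳ z) ≡ ϱ i j a ∷ʳ z
  ϱ-∷ʳ {i} {j} a z i≤j j≤a
    rewrite take-++ˡ a [ z ] (≤-trans (pred≤ i≤j) j≤a)
          | take-++ˡ a [ z ] j≤a
          | drop-++ˡ a [ z ] j≤a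
          = trans (cong (take (i ∸ 1) a ++_) (sym (++-assoc middle (drop j a) [ z ])))
                  (sym (++-assoc (take (i ∸ 1) a) (middle ++ drop j a) [ z ]))
    where middle = reverse (map -_ (drop (i ∸ 1) (take j a)))

  length-ϱ : ∀ {i j} (a : List ℤ) → i ≤ j → length (ϱ i j a) ≡ length a
  length-ϱ {i} {j} a i≤j = begin
    length (take k a ++ reverse (map -_ (drop k (take j a))) ++ drop j a)
      ≡⟨ trans (length-++ (take k a)) (cong (λ l → length (take k a) + l) (length-++ (reverse (map -_ (drop k (take j a)))))) ⟩
    length (take k a) + (length (reverse (map -_ (drop k (take j a)))) + length (drop j a))
      ≡⟨ cong (λ l → length (take k a) + (l + length (drop j a)))
              (trans (length-reverse (map -_ (drop k (take j a)))) (length-map -_ (drop k (take j a)))) ⟩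
    length (take k a) + (length (drop k (take j a)) + length (drop j a))
      ≡⟨ trans (length-++ (take k a)) (cong (λ l → length (take k a) + l) (length-++ (drop k (take j a)))) ⟨
    length (take k a ++ drop k (take j a) ++ drop j a)
      ≡⟨ cong length (split k j a (pred≤ i≤j)) ⟩
    length a ∎
    where
    open ≡-Reasoning
    k = i ∸ 1
    split : ∀ k j (a : List ℤ) → k ≤ j → take k a ++ drop k (take j a) ++ drop j a ≡ a
    split zero    j       a        _        = take++drop≡id j a
    split (suc k) (suc j) []       _        = refl
    split (suc k) (suc j) (x ∷ a)  (s≤s le) = cong (x ∷_) (split k j a le)

  sortsIn-∷ʳ : ∀ {n d b} → length b ≡ n → SortsIn n d b →
               SortsIn (suc n) d (b ∷ʳ (+ suc n))
  sortsIn-∷ʳ {n} len (done refl) = done (applyUpTo-∷ʳ _ n)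
  sortsIn-∷ʳ {b = b} len (step i j 1≤i i≤j j≤n s) =
    step i j 1≤i i≤j (m≤n⇒m≤1+n j≤n)
      (subst (SortsIn _ _)
             (sym (ϱ-∷ʳ b _ i≤j (≤-trans j≤n (≤-reflexive (sym len)))))
             (sortsIn-∷ʳ (trans (length-ϱ b i≤j) len) s))

  abs-≡ : ∀ z {m} → ∣ z ∣ ≡ suc m → z ≡ + suc m ⊎ z ≡ - (+ suc m)
  abs-≡ (+ _)    refl = inj₁ refl
  abs-≡ -[1+ _ ] refl = inj₂ refl

  length-entries : ∀ {n} {a : List ℤ} → map ∣_∣ a ↭ applyUpTo suc n → length a ≡ n
  length-entries {n} {a} p =
    trans (sym (length-map ∣_∣ a)) (trans (↭-length p) (length-applyUpTo suc n))

  abs-reverse-neg : ∀ (ys : List ℤ) → map ∣_∣ (reverse (map -_ ys)) ↭ map ∣_∣ ys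
  abs-reverse-neg ys =
    ↭-trans (map⁺ ∣_∣ (↭-reverse (map -_ ys)))
            (↭-reflexive (trans (sym (map-∘ ys)) (map-cong ∣-i∣≡∣i∣ ys)))

sortable : ∀ n {a} → map ∣_∣ a ↭ applyUpTo suc n → ∃ λ d → SortsIn n d a
sortable zero    {[]}    p = 0 , done refl
sortable zero    {x ∷ a} p with () ← ↭-length p
sortable (suc n) {a}     p
  with x , x∈a , eq ← ∈-map⁻ ∣_∣ (∈-resp-↭ (↭-sym p)
         (subst (suc n ∈_) (applyUpTo-∷ʳ suc n) (∈-++⁺ʳ (applyUpTo suc n) (here refl))))
  with xs , ys , refl ← ∈-∃++ x∈a
  = final (abs-≡ (- x) (trans (∣-i∣≡∣i∣ x) (sym eq)))
  where
  b = xs ++ reverse (map -_ ys)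

  lenA : length (xs ++ x ∷ ys) ≡ suc n
  lenA = length-entries p

  ϱ₁ : ϱ (suc (length xs)) (suc n) (xs ++ x ∷ ys) ≡ b ∷ʳ (- x)
  ϱ₁ = trans (ϱ-suffix xs (x ∷ ys) lenA)
      (trans (cong (xs ++_) (unfold-reverse (- x) (map -_ ys)))
             (sym (++-assoc xs (reverse (map -_ ys)) [ - x ])))

  pos≤ : suc (length xs) ≤ suc n
  pos≤ = subst (suc (length xs) ≤_) lenA
    (≤-trans (s≤s (m≤m+n (length xs) (length ys)))
      (≤-reflexive (sym (trans (length-++ xs) (+-suc (length xs) (length ys))))))

  pb : map ∣_∣ b ↭ applyUpTo suc n
  pb = ↭-trans (↭-reflexive (map-++ ∣_∣ xs _))
      (↭-trans (++⁺ˡ (map ∣_∣ xs) (abs-reverse-neg ys))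
      (↭-trans (drop-mid (map ∣_∣ xs) (applyUpTo suc n)
                 (↭-trans (↭-reflexive (trans (cong (λ k → map ∣_∣ xs ++ k ∷ map ∣_∣ ys) eq) (sym (map-++ ∣_∣ xs (x ∷ ys)))))
                 (↭-trans p (↭-reflexive (sym (applyUpTo-∷ʳ suc n))))))
        (↭-reflexive (++-identityʳ _))))

  lenB : length b ≡ n
  lenB = length-entries pb

  sorted-b : ∃ λ d → SortsIn (suc n) d (b ∷ʳ (+ suc n))
  sorted-b with d , s ← sortable n pb = d , sortsIn-∷ʳ lenB s

  flip-last : - x ≡ - (+ suc n) →
              ϱ (suc n) (suc n) (b ∷ʳ (- x)) ≡ b ∷ʳ (+ suc n)
  flip-last -x≡ = trans
    (cong (λ k → ϱ (suc k) (suc n) (b ∷ʳ (- x))) (sym lenB))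
    (trans (ϱ-suffix b [ - x ] (trans (length-++ b) (trans (+-comm _ 1) (cong suc lenB))))
           (cong (λ z → b ∷ʳ z) (trans (cong -_ -x≡) (neg-involutive (+ suc n)))))

  final : - x ≡ + suc n ⊎ - x ≡ - (+ suc n) → ∃ λ d → SortsIn (suc n) d (xs ++ x ∷ ys)
  final (inj₁ -x≡) with d , s ← sorted-b =
    suc d , step _ _ (s≤s z≤n) pos≤ ≤-refl
      (subst (SortsIn (suc n) d) (sym (trans ϱ₁ (cong (λ z → b ∷ʳ z) -x≡))) s)
  final (inj₂ -x≡) with d , s ← sorted-b =
    suc (suc d) , step _ _ (s≤s z≤n) pos≤ ≤-refl
      (subst (SortsIn (suc n) (suc d)) (sym ϱ₁)
        (step _ _ (s≤s z≤n) ≤-refl ≤-refl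
          (subst (SortsIn (suc n) d) (sym (flip-last -x≡)) s)))

minimum : ∀ {P : ℕ → Set} → Decidable P → ∀ {n} → P n →
          ∃ λ m → P m × (∀ k → P k → m ≤ k)
minimum P? {zero}  p = zero , p , λ _ _ → z≤n
minimum P? {suc n} p with P? zero
... | yes p₀ = zero , p₀ , λ _ _ → z≤n
... | no ¬p₀ with m , pₘ , least ← minimum (P? ∘ suc) {n} p =
  suc m , pₘ , λ { zero p₀ → contradiction p₀ ¬p₀ ; (suc k) pₖ → s≤s (least k pₖ) }

reversalDistance : ∀ {n} (a : SignedPermutation n) →
  ∃ λ d → SortsIn n d (entries a) × (∀ k → SortsIn n k (entries a) → d ≤ k)
reversalDistance {n} a with _ , s ← sortable n (absolute-values a) =
  minimum (sortsIn? n (entries a)) s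

dᵣ : ∀ {n} → SignedPermutation n → ℕ
dᵣ a = proj₁ (reversalDistance a)

-- Permutations of {0, 1, …, n} ∪ {-1, …, -n}, represented as maps ℤ → ℤ
-- which fix every integer outside this set.

symbols : ℕ → List ℤ
symbols n = map +_ (upTo (suc n)) ++ map -[1+_] (upTo n)

-- Cycle notation: the permutation (x₀ x₁ ⋯ xₖ), for distinct xᵢ.
-- In `next x₀ x xs`, the list x ∷ xs is what remains of x₀ ∷ ⋯ ∷ xₖ.
next : ℤ → ℤ → List ℤ → ℤ → ℤ
next x₀ x []       z = if does (z ≟ x) then x₀ else z
next x₀ x (y ∷ ys) z = if does (z ≟ x) then y  else next x₀ y ys z

cycle : List ℤ → ℤ → ℤ
cycle []       z = z
cycle (x ∷ xs) z = next x x xs z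

s̃ : ∀ {n} → SignedPermutation n → ℤ → ℤ
s̃ a = cycle (0ℤ ∷ entries a ++ reverse (map -_ (entries a)))

pᵣ : ℕ → ℤ → ℤ
pᵣ n = cycle (map -_ (e n) ++ reverse (e n) ++ [ 0ℤ ])

-- For a permutation f of a set of N elements, the exponents below N
-- already run through the whole cycle of x.
SameCycle : ℕ → (ℤ → ℤ) → ℤ → ℤ → Set
SameCycle N f x y = ∃ λ k → k < N × iterate f x k ≡ y

sameCycle? : ∀ N f x y → Dec (SameCycle N f x y)
sameCycle? N f x y = anyUpTo? (λ k → iterate f x k ≟ y) N

-- The number of cycles of a permutation f of the elements of S (listed
-- without repetition): `deduplicate` keeps one element of each cycle.
C : List ℤ → (ℤ → ℤ) → ℕ
C S f = length (deduplicate (sameCycle? (length S) f) S)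

{-# OPTIONS --safe #-}

-- View a list of symbols as a walk: given r : ℤ → ℤ, the symbol x is an edge
-- from r (p x) to r x.  The symbols 0, a₁, …, aₙ, -aₙ, …, -a₁ form a closed
-- walk exactly when r is constant on the cycles of p ∘ s̃.  For a = eₙ we may
-- take r = id, with 2n+1 values.  A reversal exchanges two blocks of this
-- closed walk, and to restore a closed walk it suffices to identify two pairs
-- of values of r.  Hence d reversals leave an invariant r with at least
-- 2n+1-2d values, so there are at least that many cycles.

module Submission where

open import Defs
open import Data.Empty using (⊥)
open import Data.Integer.Base using (ℤ; +_; -[1+_]; +[1+_]; -_; ∣_∣; 0ℤ; _-_; _⊖_)
  renaming (_*_ to _*ℤ_; _≤_ to _≤ℤ_)
open import Data.Integer.Properties using (_≟_; neg-involutive; +-injective; -[1+-injective; m-n≡m⊖n; ⊖-monoˡ-≤; ⊖-≥; pos-*; ∣-i∣≡∣i∣)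
  renaming (*-identityʳ to *ℤ-identityʳ; module ≤-Reasoning to ≤ℤ-Reasoning)
open import Data.List.Base using (List; []; _∷_; _∷ʳ_; [_]; _++_; map; reverse; length; take; drop; upTo; applyUpTo; filter)
open import Data.List.Membership.DecPropositional _≟_ using (_∈?_)
open import Data.List.Membership.Propositional using (_∈_; _∉_)
open import Data.List.Membership.Propositional.Properties using (∈-map⁺; ∈-map⁻; ∈-++⁺ˡ; ∈-++⁺ʳ; ∈-++⁻; ∈-filter⁻)
open import Data.List.Properties using (++-assoc; map-++; map-∘; map-cong; map-id; map-applyUpTo; unfold-reverse; reverse-++; reverse-map; reverse-involutive; length-++; length-map; length-applyUpTo; take++drop≡id; filter-all)
open import Data.List.Relation.Binary.Permutation.Propositional using (_↭_; prep; ↭-sym; ↭-trans; ↭-reflexive; ↭⇒↭ₛ)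
open import Data.List.Relation.Binary.Permutation.Propositional.Properties using (∈-resp-↭; ++⁺ˡ; ↭-reverse)
open import Data.List.Relation.Binary.Permutation.Setoid.Properties using (Unique-resp-↭)
open import Data.List.Relation.Unary.All using (All; []; _∷_; lookup)
import Data.List.Relation.Unary.All as All
open import Data.List.Relation.Unary.AllPairs using (_∷_)
open import Data.List.Relation.Unary.Any using (Any; here; there)
import Data.List.Relation.Unary.Any as Any
open import Data.List.Relation.Unary.Any.Properties using (deduplicate⁺; reverse⁺; reverse⁻)
open import Data.List.Relation.Unary.Unique.Propositional using (Unique)
import Data.List.Relation.Unary.Unique.Propositional.Properties as Unique
open import Data.Nat.Base using (ℕ; zero; suc; _+_; _*_; _∸_; _≤_; z≤n; s≤s)
open import Data.Nat.GeneralisedArithmetic using (iterate)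
open import Data.Nat.Properties using (≤-trans; ≤-reflexive; m≤m+n; m+n∸m≡n; +-suc; +-comm; +-identityʳ; +-monoˡ-≤; *-suc; *-comm; pred[n]≤n)
open import Data.Product.Base using (∃; _×_; _,_; proj₁; proj₂)
open import Data.Rational.Base using (_/_; _≥_)
open import Data.Rational.Properties using (toℚᵘ-cancel-≤; toℚᵘ-fromℚᵘ)
open import Data.Rational.Unnormalised.Base using (mkℚᵘ; *≤*)
import Data.Rational.Unnormalised.Properties as ℚᵘ
open import Data.Sum.Base using (_⊎_; inj₁; inj₂)
open import Function.Base using (_∘_; id)
open import Relation.Binary.PropositionalEquality using (_≡_; _≢_; refl; sym; trans; cong; cong₂; subst; setoid; module ≡-Reasoning)
open import Relation.Nullary.Decidable using (yes; no; ¬?)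
open import Relation.Nullary.Negation using (contradiction)

private variable
  c c₁ c′ x z : ℤ
  xs ys : List ℤ

-- Counting values

delete : ℤ → List ℤ → List ℤ
delete u = filter (λ v → ¬? (v ≟ u))

length-delete : ∀ u → Unique xs → length xs ≤ suc (length (delete u xs))
length-delete {[]}     u _ = z≤n
length-delete {x ∷ xs} u (x∉xs ∷ xs!) with x ≟ u
... | no _     = s≤s (length-delete u xs!)
... | yes refl = s≤s (≤-reflexive (cong length (sym
  (filter-all (λ v → ¬? (v ≟ u)) (All.map (λ x≢v v≡x → x≢v (sym v≡x)) x∉xs)))))

delete-! : ∀ u → Unique xs → Unique (delete u xs)
delete-! u = Unique.filter⁺ (λ v → ¬? (v ≟ u))

∈-delete⁻ : ∀ u → z ∈ delete u xs → z ∈ xs × z ≢ u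
∈-delete⁻ u = ∈-filter⁻ (λ v → ¬? (v ≟ u))

Value : (ℤ → ℤ) → List ℤ → ℤ → Set
Value r S v = Any (λ z → r z ≡ v) S

-- Pigeonhole by recursion on `S`: the element `y` accounts for the single value `r y`, and once
-- that value is deleted every remaining one must be attained on the tail.
length-values≤ : ∀ r S {V} → Unique V → (∀ {v} → v ∈ V → Value r S v) → length V ≤ length S
length-values≤ r []      {[]}    _  _  = z≤n
length-values≤ r []      {v ∷ V} _  ⊆S with () ← ⊆S (here refl)
length-values≤ r (y ∷ S) {V}     V! ⊆S = ≤-trans (length-delete (r y) V!)
  (s≤s (length-values≤ r S (delete-! (r y) V!) ⊆S′))
  where
  ⊆S′ : ∀ {v} → v ∈ delete (r y) V → Value r S v
  ⊆S′ v∈ with v∈V , v≢ ← ∈-delete⁻ (r y) v∈ with ⊆S v∈V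
  ... | here eq = contradiction (sym eq) v≢
  ... | there p = p

record Values (S : List ℤ) (k : ℕ) (r : ℤ → ℤ) : Set where
  field
    values   : List ℤ
    distinct : Unique values
    attained : ∀ {v} → v ∈ values → Value r S v
    many     : length S ≤ length values + k

replace : ℤ → ℤ → ℤ → ℤ
replace u w v with v ≟ u
... | yes _ = w
... | no  _ = v

replace-≡ : ∀ u w → replace u w u ≡ w
replace-≡ u w with u ≟ u
... | yes _  = refl
... | no u≢u = contradiction refl u≢u

replace-≢ : ∀ {u} w {v} → v ≢ u → replace u w v ≡ v
replace-≢ {u} w {v} v≢u with v ≟ u
... | yes v≡u = contradiction v≡u v≢u
... | no  _   = refl

replace-target : ∀ u w → replace u w w ≡ w
replace-target u w with w ≟ u
... | yes _ = refl
... | no  _ = refl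

-- Merging `u` into `w` leaves every value other than `u` attained, so at most one value is lost.
replace-values : ∀ {S k r} u w → Values S k r → Values S (suc k) (replace u w ∘ r)
replace-values {S} {k} u w Vs = record
  { values   = delete u values
  ; distinct = delete-! u distinct
  ; attained = λ v∈ → let v∈V , v≢u = ∈-delete⁻ u v∈ in
      Any.map (λ eq → trans (cong (replace u w) eq) (replace-≢ w v≢u)) (attained v∈V)
  ; many     = ≤-trans many (≤-trans (+-monoˡ-≤ k (length-delete u distinct))
                 (≤-reflexive (sym (+-suc _ k))))
  }
  where open Values Vs

-- Walks

data Walk (p r : ℤ → ℤ) : ℤ → List ℤ → ℤ → Set where
  []  : Walk p r c [] c
  _∷_ : r (p x) ≡ c → Walk p r (r x) xs c′ → Walk p r c (x ∷ xs) c′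

module _ {p r : ℤ → ℤ} where

  walk-++⁺ : Walk p r c xs c₁ → Walk p r c₁ ys c′ → Walk p r c (xs ++ ys) c′
  walk-++⁺ []       v = v
  walk-++⁺ (eq ∷ w) v = eq ∷ walk-++⁺ w v

  walk-++⁻ : ∀ xs → Walk p r c (xs ++ ys) c′ → ∃ λ c₁ → Walk p r c xs c₁ × Walk p r c₁ ys c′
  walk-++⁻ []       w        = _ , [] , w
  walk-++⁻ (x ∷ xs) (eq ∷ w) with c₁ , w₁ , w₂ ← walk-++⁻ xs w = c₁ , eq ∷ w₁ , w₂

  walk-map : ∀ m → Walk p r c xs c′ → Walk p (m ∘ r) (m c) xs (m c′)
  walk-map m []       = []
  walk-map m (eq ∷ w) = cong m eq ∷ walk-map m w

  -- If `y` follows `z` in the list, the edge condition of `y` is the equation itself: the edge `y`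
  -- starts where `z` ends. The argument `w` is the first entry of the whole cycle and stays fixed
  -- in the recursion, to serve as successor of the last entry.
  walk-next : ∀ w → Walk p r c (x ∷ xs) (r (p w)) → z ∈ x ∷ xs → r (p (next w x xs z)) ≡ r z
  walk-next {x = x} {[]} {z} w walk z∈ with z ≟ x
  -- Here `z` is the last entry, so its endpoint `r z` is the end `r (p w)` of the walk.
  walk-next w (_ ∷ walk) z∈ | yes refl = closing walk
    where
    closing : ∀ {a b} → Walk p r a [] b → b ≡ a
    closing [] = refl
  walk-next w walk (here z≡x) | no z≢x = contradiction z≡x z≢x
  walk-next {x = x} {y ∷ ys} {z} w walk z∈ with z ≟ x
  walk-next w (_ ∷ (eq ∷ _)) z∈ | yes refl = eq
  walk-next w walk (here z≡x) | no z≢x = contradiction z≡x z≢x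
  walk-next w (_ ∷ walk) (there z∈) | no _ = walk-next w walk z∈

  walk-cycle : Walk p r c xs c → z ∈ xs → r (p (cycle xs z)) ≡ r z
  walk-cycle {xs = x ∷ xs} (refl ∷ walk) = walk-next x (refl ∷ walk)

-- Evaluating cycle notation

next-∉ : ∀ w x xs → z ∉ x ∷ xs → next w x xs z ≡ z
next-∉ {z} w x [] z∉ with z ≟ x
... | yes z≡x = contradiction (here z≡x) z∉
... | no _    = refl
next-∉ {z} w x (y ∷ ys) z∉ with z ≟ x
... | yes z≡x = contradiction (here z≡x) z∉
... | no _    = next-∉ w y ys (z∉ ∘ there)

cycle-∉ : ∀ xs → z ∉ xs → cycle xs z ≡ z
cycle-∉ []       _  = refl
cycle-∉ (x ∷ xs) z∉ = next-∉ x x xs z∉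

next-head : ∀ w x y ys → next w x (y ∷ ys) x ≡ y
next-head w x y ys with x ≟ x
... | yes _  = refl
... | no x≢x = contradiction refl x≢x

next-last : ∀ w x → next w x [] x ≡ w
next-last w x with x ≟ x
... | yes _  = refl
... | no x≢x = contradiction refl x≢x

next-tail : ∀ w x y ys → x ≢ z → next w x (y ∷ ys) z ≡ next w y ys z
next-tail {z} w x y ys x≢z with z ≟ x
... | yes z≡x = contradiction (sym z≡x) x≢z
... | no _    = refl

-- Under the label `id` the edge `x` runs from its successor `p x` to `x`, so reading the cycle
-- backwards gives a walk. Distinctness lets the agreement of `p` with `next` pass to the tail of
-- the list.
walk-reverse-next : ∀ {p} w x xs → Unique (x ∷ xs) → (∀ {z} → z ∈ x ∷ xs → p z ≡ next w x xs z) →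
                    Walk p id w (reverse (x ∷ xs)) x
walk-reverse-next w x []       _           p≗ = trans (p≗ (here refl)) (next-last w x) ∷ []
walk-reverse-next {p} w x (y ∷ ys) (x∉ ∷ xs!) p≗ =
  subst (λ l → Walk p id w l x) (sym (unfold-reverse x (y ∷ ys)))
    (walk-++⁺
      (walk-reverse-next w y ys xs! (λ z∈ → trans (p≗ (there z∈)) (next-tail w x y ys (lookup x∉ z∈))))
      (trans (p≗ (here refl)) (next-head w x y ys) ∷ []))

walk-reverse-cycle : ∀ xs → Unique xs → ∃ λ c → Walk (cycle xs) id c (reverse xs) c
walk-reverse-cycle []       _   = 0ℤ , []
walk-reverse-cycle (x ∷ xs) xs! = x , walk-reverse-next x x xs xs! (λ _ → refl)

-- Closed walks with many labels, and block interchange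

record Certificate (p : ℤ → ℤ) (S : List ℤ) (k : ℕ) (xs : List ℤ) : Set where
  field
    label      : ℤ → ℤ
    base       : ℤ
    walk       : Walk p label base xs base
    manyValues : Values S k label

-- Identify c₁ with c₃ and c₂ with c₄, where the closed walk is
-- c —A→ c₁ —D→ c₂ —M→ c₃ —B→ c₄ —E→ c.
block-interchange : ∀ {p S k} A B M D E → Certificate p S k (A ++ D ++ M ++ B ++ E) →
                    Certificate p S (suc (suc k)) (A ++ B ++ M ++ D ++ E)
block-interchange {p} A B M D E cert
  with c₁ , wA , w ← walk-++⁻ A (Certificate.walk cert)
  with c₂ , wD , w ← walk-++⁻ D w
  with c₃ , wM , w ← walk-++⁻ M w
  with c₄ , wB , wE ← walk-++⁻ B w
  = record
  { label      = m ∘ label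
  ; base       = m base
  -- After `c₁`, `c₃` and `c₂`, `c₄` are merged, the blocks `A`, `B`, `M`, `D`, `E` fit end to end:
  -- each junction joins two merged values, and each `subst` rewrites the starting point of a block.
  ; walk       =
      walk-++⁺ (walk-map m wA)
      (walk-++⁺ (subst (λ v → Walk p (m ∘ label) v B (m c₄)) (sym m₁₃) (walk-map m wB))
      (walk-++⁺ (subst (λ v → Walk p (m ∘ label) v M (m c₃)) m₂₄ (walk-map m wM))
      (walk-++⁺ (subst (λ v → Walk p (m ∘ label) v D (m c₂)) m₁₃ (walk-map m wD))
      (subst (λ v → Walk p (m ∘ label) v E (m base)) (sym m₂₄) (walk-map m wE)))))
  ; manyValues = replace-values (f c₂) (f c₄) (replace-values c₁ c₃ manyValues)
  }
  where
  open Certificate cert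
  f = replace c₁ c₃
  -- The first identification may already have moved `c₂` or `c₄`, so the second one merges their
  -- images under `f`.
  m = replace (f c₂) (f c₄) ∘ f

  m₁₃ : m c₁ ≡ m c₃
  m₁₃ = cong (replace (f c₂) (f c₄)) (trans (replace-≡ c₁ c₃) (sym (replace-target c₁ c₃)))

  m₂₄ : m c₂ ≡ m c₄
  m₂₄ = trans (replace-≡ (f c₂) (f c₄)) (sym (replace-target (f c₂) (f c₄)))

-- The word of s̃ and reversals

negReverse : List ℤ → List ℤ
negReverse xs = reverse (map -_ xs)

-- The cycle of `s̃` written out: `s̃ a` is `cycle (word (entries a))` by definition.
word : List ℤ → List ℤ
word a = 0ℤ ∷ a ++ negReverse a

negReverse-++ : ∀ xs ys → negReverse (xs ++ ys) ≡ negReverse ys ++ negReverse xs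
negReverse-++ xs ys = trans (cong reverse (map-++ -_ xs ys)) (reverse-++ (map -_ xs) (map -_ ys))

negReverse-involutive : ∀ xs → negReverse (negReverse xs) ≡ xs
negReverse-involutive xs = begin
  reverse (map -_ (reverse (map -_ xs))) ≡⟨ cong reverse (reverse-map -_ (map -_ xs)) ⟩
  reverse (reverse (map -_ (map -_ xs))) ≡⟨ reverse-involutive _ ⟩
  map -_ (map -_ xs)                     ≡⟨ map-∘ xs ⟨
  map (λ z → - (- z)) xs                 ≡⟨ map-cong neg-involutive xs ⟩
  map id xs                              ≡⟨ map-id xs ⟩
  xs                                     ∎
  where open ≡-Reasoning

-- Isolates the segment `Y` to be reversed and its mirror image `negReverse Y`, the two blocks that
-- a reversal exchanges.
word-blocks : ∀ X Y Z → word (X ++ Y ++ Z) ≡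
              (0ℤ ∷ X) ++ Y ++ (Z ++ negReverse Z) ++ negReverse Y ++ negReverse X
word-blocks X Y Z = cong (0ℤ ∷_) (begin
  (X ++ Y ++ Z) ++ negReverse (X ++ Y ++ Z)
    ≡⟨ cong ((X ++ Y ++ Z) ++_) (trans (negReverse-++ X (Y ++ Z))
         (trans (cong (_++ negReverse X) (negReverse-++ Y Z)) (++-assoc (negReverse Z) _ _))) ⟩
  (X ++ Y ++ Z) ++ T
    ≡⟨ ++-assoc X (Y ++ Z) T ⟩
  X ++ (Y ++ Z) ++ T
    ≡⟨ cong (X ++_) (++-assoc Y Z T) ⟩
  X ++ Y ++ Z ++ T
    ≡⟨ cong (λ l → X ++ Y ++ l) (++-assoc Z (negReverse Z) _) ⟨
  X ++ Y ++ (Z ++ negReverse Z) ++ negReverse Y ++ negReverse X ∎)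
  where
  open ≡-Reasoning
  T = negReverse Z ++ negReverse Y ++ negReverse X

take-drop-drop : ∀ {k j} (a : List ℤ) → k ≤ j → take k a ++ drop k (take j a) ++ drop j a ≡ a
take-drop-drop {j = j} a       z≤n      = take++drop≡id j a
take-drop-drop         []      (s≤s _)  = refl
take-drop-drop         (x ∷ a) (s≤s le) = cong (x ∷_) (take-drop-drop a le)

-- A reversal replaces `Y` by `negReverse Y`, and in the word this swaps the two blocks around
-- `Z ++ negReverse Z`. Certificates are carried backwards, from the reversed list to `a`, at the
-- cost of two values.
certificate-ϱ : ∀ {p S k i j} a → i ≤ j → Certificate p S k (word (ϱ i j a)) →
                Certificate p S (suc (suc k)) (word a)
certificate-ϱ {p} {S} {k} {i} {j} a i≤j cert =
  subst (Certificate p S _)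
    (trans (sym (word-blocks X Y Z)) (cong word (take-drop-drop a (≤-trans (pred[n]≤n {i}) i≤j))))
    (block-interchange (0ℤ ∷ X) Y (Z ++ negReverse Z) (negReverse Y) (negReverse X)
      (subst (Certificate p S k)
        (trans (word-blocks X (negReverse Y) Z)
          (cong (λ y → (0ℤ ∷ X) ++ negReverse Y ++ (Z ++ negReverse Z) ++ y ++ negReverse X)
            (negReverse-involutive Y)))
        cert))
  where
  X = take (i ∸ 1) a
  Y = drop (i ∸ 1) (take j a)
  Z = drop j a

-- The sorted permutation

word-e-↭ : ∀ n → word (e n) ↭ symbols n
word-e-↭ n = prep 0ℤ (↭-trans
  (++⁺ˡ (e n) (↭-reverse (map -_ (e n))))
  (↭-reflexive (cong₂ _++_ (sym (map-applyUpTo suc +_ n))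
    (trans (map-applyUpTo (λ k → + suc k) -_ n) (sym (map-applyUpTo id -[1+_] n))))))

symbols-! : ∀ n → Unique (symbols n)
symbols-! n = Unique.++⁺
  (Unique.map⁺ +-injective (Unique.upTo⁺ (suc n)))
  (Unique.map⁺ -[1+-injective (Unique.upTo⁺ n))
  λ (z∈+ , z∈-) → disjoint (∈-map⁻ +_ z∈+) (∈-map⁻ -[1+_] z∈-)
  where
  disjoint : ∀ {z xs ys} → (∃ λ k → k ∈ xs × z ≡ + k) → (∃ λ k → k ∈ ys × z ≡ -[1+ k ]) → ⊥
  disjoint (_ , _ , refl) (_ , _ , ())

-- The right-hand side is the list that defines `pᵣ n`, so `pᵣ n` runs backwards through the cycle
-- of the sorted permutation.
reverse-word : ∀ n → reverse (word (e n)) ≡ map -_ (e n) ++ reverse (e n) ++ [ 0ℤ ]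
reverse-word n = begin
  reverse (word (e n))                                  ≡⟨ unfold-reverse 0ℤ (e n ++ negReverse (e n)) ⟩
  reverse (e n ++ negReverse (e n)) ∷ʳ 0ℤ               ≡⟨ cong (_∷ʳ 0ℤ) (reverse-++ (e n) (negReverse (e n))) ⟩
  (reverse (negReverse (e n)) ++ reverse (e n)) ∷ʳ 0ℤ   ≡⟨ cong (λ l → (l ++ reverse (e n)) ∷ʳ 0ℤ) (reverse-involutive _) ⟩
  (map -_ (e n) ++ reverse (e n)) ∷ʳ 0ℤ                 ≡⟨ ++-assoc (map -_ (e n)) (reverse (e n)) [ 0ℤ ] ⟩
  map -_ (e n) ++ reverse (e n) ++ [ 0ℤ ]               ∎
  where open ≡-Reasoning

pᵣ≡cycle : ∀ n → pᵣ n ≡ cycle (reverse (word (e n)))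
pᵣ≡cycle n = cong cycle (sym (reverse-word n))

certificate-e : ∀ n → Certificate (pᵣ n) (symbols n) 0 (word (e n))
certificate-e n
  with c , w ← walk-reverse-cycle (reverse (word (e n)))
    (Unique-resp-↭ (setoid ℤ) (↭⇒↭ₛ (↭-sym (↭-trans (↭-reverse (word (e n))) (word-e-↭ n)))) (symbols-! n))
  = record
  { label      = id
  ; base       = c
  ; walk       = subst (λ p → Walk p id c (word (e n)) c) (sym (pᵣ≡cycle n))
                   (subst (λ l → Walk (cycle (reverse (word (e n)))) id c l c)
                     (reverse-involutive (word (e n))) w)
  ; manyValues = record
    { values   = symbols n
    ; distinct = symbols-! n
    ; attained = Any.map sym
    ; many     = m≤m+n _ 0
    }
  }

certificate : ∀ {n d a} → SortsIn n d a → Certificate (pᵣ n) (symbols n) (2 * d) (word a)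
certificate {n} (done refl) = certificate-e n
certificate {n} {suc d} {a} (step i j _ i≤j _ s) =
  subst (λ k → Certificate (pᵣ n) (symbols n) k (word a)) (sym (*-suc 2 d))
    (certificate-ϱ a i≤j (certificate s))

-- Counting cycles

∣∣-≡ : ∀ y z → ∣ z ∣ ≡ ∣ y ∣ → z ≡ y ⊎ z ≡ - y
∣∣-≡ (+ _)    (+ _)    refl = inj₁ refl
∣∣-≡ +[1+ _ ] -[1+ _ ] refl = inj₂ refl
∣∣-≡ -[1+ _ ] (+ _)    refl = inj₂ refl
∣∣-≡ -[1+ _ ] -[1+ _ ] refl = inj₁ refl

∈-word⁺ : ∀ a → ∣ z ∣ ∈ map ∣_∣ a → z ∈ word a
∈-word⁺ {z} a ∣z∣∈ with y , y∈a , eq ← ∈-map⁻ ∣_∣ ∣z∣∈ with ∣∣-≡ y z eq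
... | inj₁ refl = there (∈-++⁺ˡ y∈a)
... | inj₂ refl = there (∈-++⁺ʳ a (reverse⁺ (∈-map⁺ -_ y∈a)))

∈-word⁻ : ∀ a → z ∈ word a → z ≡ 0ℤ ⊎ ∣ z ∣ ∈ map ∣_∣ a
∈-word⁻ a (here z≡0) = inj₁ z≡0
∈-word⁻ a (there z∈) with ∈-++⁻ a z∈
... | inj₁ z∈a = inj₂ (∈-map⁺ ∣_∣ z∈a)
... | inj₂ z∈ā with y , y∈a , refl ← ∈-map⁻ -_ (reverse⁻ z∈ā) =
  inj₂ (subst (_∈ map ∣_∣ a) (sym (∣-i∣≡∣i∣ y)) (∈-map⁺ ∣_∣ y∈a))

-- Apart from 0, membership in a word depends only on the absolute value. It follows that `pᵣ n`
-- fixes every integer outside the word of `a`.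
word-e⊆word : ∀ {n} (a : SignedPermutation n) → z ∈ word (e n) → z ∈ word (entries a)
word-e⊆word {z} {n} a z∈ with ∈-word⁻ (e n) z∈
... | inj₁ z≡0  = here z≡0
... | inj₂ ∣z∣∈ = ∈-word⁺ (entries a) (∈-resp-↭ (↭-sym (absolute-values a))
  (subst (∣ z ∣ ∈_) (map-applyUpTo (λ k → + suc k) ∣_∣ n) ∣z∣∈))

pᵣ-∉ : ∀ {n} (a : SignedPermutation n) → z ∉ word (entries a) → pᵣ n z ≡ z
pᵣ-∉ {z} {n} a z∉ = trans (cong (λ p → p z) (pᵣ≡cycle n))
  (cycle-∉ (reverse (word (e n))) (z∉ ∘ word-e⊆word a ∘ reverse⁻))

iterate-invariant : ∀ (r f : ℤ → ℤ) → (∀ z → r (f z) ≡ r z) → ∀ z k → r (iterate f z k) ≡ r z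
iterate-invariant r f inv z zero    = refl
iterate-invariant r f inv z (suc k) = trans (iterate-invariant r f inv (f z) k) (inv z)

-- Since `r` is constant along iterates of `f`, a value attained on `S` is still attained on the
-- representatives kept by `deduplicate`, so distinct values number at most `C S f`.
invariant⇒cycles : ∀ {S k} (r f : ℤ → ℤ) → (∀ z → r (f z) ≡ r z) → Values S k r →
                   length S ≤ C S f + k
invariant⇒cycles {S} {k} r f inv Vs = ≤-trans many
  (+-monoˡ-≤ k (length-values≤ r _ distinct
    (λ v∈ → deduplicate⁺ (sameCycle? (length S) f)
      (λ { (i , _ , refl) eq → trans (sym (iterate-invariant r f inv _ i)) eq }) (attained v∈))))
  where open Values Vs

length-symbols : ∀ n → length (symbols n) ≡ 2 * n + 1
length-symbols n = begin
  suc (length (map +_ (applyUpTo suc n) ++ map -[1+_] (upTo n)))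
    ≡⟨ cong suc (length-++ (map +_ (applyUpTo suc n))) ⟩
  suc (length (map +_ (applyUpTo suc n)) + length (map -[1+_] (upTo n)))
    ≡⟨ cong suc (cong₂ _+_ (trans (length-map +_ (applyUpTo suc n)) (length-applyUpTo suc n))
                           (trans (length-map -[1+_] (upTo n)) (length-applyUpTo id n))) ⟩
  suc (n + n)   ≡⟨ cong (λ m → suc (n + m)) (+-identityʳ n) ⟨
  suc (2 * n)   ≡⟨ +-comm 1 (2 * n) ⟩
  2 * n + 1     ∎
  where open ≡-Reasoning

sortsIn⇒cycles : ∀ {n d} (a : SignedPermutation n) → SortsIn n d (entries a) →
                 2 * n + 1 ≤ C (symbols n) (pᵣ n ∘ s̃ a) + 2 * d
sortsIn⇒cycles {n} {d} a s = subst (_≤ C (symbols n) (pᵣ n ∘ s̃ a) + 2 * d) (length-symbols n)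
  (invariant⇒cycles label (pᵣ n ∘ s̃ a) invariant manyValues)
  where
  open Certificate (certificate s)
  invariant : ∀ z → label (pᵣ n (s̃ a z)) ≡ label z
  -- Invariance is required on all of `ℤ`: on the word it comes from the closed walk, and elsewhere
  -- both permutations fix `z`.
  invariant z with z ∈? word (entries a)
  ... | yes z∈ = walk-cycle walk z∈
  ... | no  z∉ = cong label (trans (cong (pᵣ n) (cycle-∉ (word (entries a)) z∉)) (pᵣ-∉ a z∉))

-- The inequality over the rationals

half-≤ : ∀ m k d → m ≤ k + 2 * d → + d / 1 ≥ (+ m - + k) / 2
half-≤ m k d m≤ = toℚᵘ-cancel-≤
  -- Unnormalised fractions reduce the claim to cross multiplication in `ℤ`. `mkℚᵘ` takes the
  -- denominator minus one, so 1 and 0 stand for the denominators 2 and 1.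
  (ℚᵘ.≤-respˡ-≃ (ℚᵘ.≃-sym (toℚᵘ-fromℚᵘ (mkℚᵘ (+ m - + k) 1)))
    (ℚᵘ.≤-respʳ-≃ (ℚᵘ.≃-sym (toℚᵘ-fromℚᵘ (mkℚᵘ (+ d) 0))) (*≤* cross)))
  where
  open ≤ℤ-Reasoning
  cross : (+ m - + k) *ℤ + 1 ≤ℤ + d *ℤ + 2
  cross = begin
    (+ m - + k) *ℤ + 1   ≡⟨ *ℤ-identityʳ (+ m - + k) ⟩
    + m - + k            ≡⟨ m-n≡m⊖n m k ⟩
    m ⊖ k                ≤⟨ ⊖-monoˡ-≤ k m≤ ⟩
    (k + 2 * d) ⊖ k      ≡⟨ ⊖-≥ (m≤m+n k (2 * d)) ⟩
    + (k + 2 * d ∸ k)    ≡⟨ cong +_ (m+n∸m≡n k (2 * d)) ⟩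
    + (2 * d)            ≡⟨ cong +_ (*-comm 2 d) ⟩
    + (d * 2)            ≡⟨ pos-* d 2 ⟩
    + d *ℤ + 2           ∎

theorem7 : (n : ℕ) → 1 ≤ n → (a : SignedPermutation n) →
    + dᵣ a / 1 ≥ (+ (2 * n + 1) - + C (symbols n) (pᵣ n ∘ s̃ a)) / 2
-- The minimum is attained, so the bound for an arbitrary sorting applies to one with exactly `dᵣ a`
-- reversals.
theorem7 n _ a = half-≤ (2 * n + 1) (C (symbols n) (pᵣ n ∘ s̃ a)) (dᵣ a)
  (sortsIn⇒cycles a (proj₁ (proj₂ (reversalDistance a))))
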